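{- $gr^3_2(B_{11})=19$.
   Context: $K_n$ is the complete graph of order $n$. The book $B_n:=K_2+nK_1$ (graph join) is the graph on $n+2$ vertices consisting of an edge $xy$ (the spine) together with $n$ further, pairwise non-adjacent vertices (the pages), each adjacent to both $x$ and $y$. A $t$-coloring of $K_p$ is a map $f:E(K_p)\to\{1,\dots,t\}$, not assumed surjective. A Gallai $t$-coloring is a $t$-coloring with no rainbow triangle, i.e. there are no three vertices $x,y,z$ such that $f(xy),f(xz),f(yz)$ are pairwise distinct. For $1\le s<t$ and a graph $G$, the weakened Gallai-Ramsey number $gr^t_s(G)$ is the least $p\in\mathbb{N}$ such that every Gallai $t$-coloring of $K_p$ contains a (not necessarily induced) subgraph isomorphic to $G$ whose edges use at most $s$ colors. -}

module Defs where

open import Data.Nat.Base using (ℕ; _≤_)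
open import Data.Fin.Base using (Fin)
open import Data.Fin.Subset using (Subset; _∈_; ∣_∣)
open import Data.Product.Base using (Σ; ∃; _×_; _,_)
open import Data.Sum.Base using (_⊎_; inj₁; inj₂)
open import Data.Unit.Base using (⊤; tt)
open import Function.Definitions using (Injective)
open import Relation.Nullary.Negation.Core using (¬_)
open import Relation.Binary.PropositionalEquality.Core using (_≡_; _≢_; refl; ≢-sym)

record Graph : Set₁ where
  field
    Vertex : Set
    Adj    : Vertex → Vertex → Set
    sym    : ∀ {u v} → Adj u v → Adj v u
    irrefl : ∀ {v} → ¬ Adj v v

open Graph public using (Vertex; Adj)

K : ℕ → Graph
K n = record
  { Vertex = Fin n
  ; Adj    = _≢_
  ; sym    = ≢-sym
  ; irrefl = λ v≢v → v≢v refl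
  }

infixl 7 _∙_
infixl 6 _+_

-- n disjoint copies of G.
_∙_ : ℕ → Graph → Graph
n ∙ G = record
  { Vertex = Fin n × Vertex G
  ; Adj    = λ { (i , u) (j , v) → i ≡ j × Adj G u v }
  ; sym    = λ { (refl , uv) → refl , Graph.sym G uv }
  ; irrefl = λ { (_ , vv) → Graph.irrefl G vv }
  }

-- The join: disjoint union together with all edges between the two sides.
_+_ : Graph → Graph → Graph
G + H = record
  { Vertex = Vertex G ⊎ Vertex H
  ; Adj    = adj
  ; sym    = λ {u} {v} → adj-sym u v
  ; irrefl = λ {v} → adj-irrefl v
  }
  where
  adj : Vertex G ⊎ Vertex H → Vertex G ⊎ Vertex H → Set
  adj (inj₁ u) (inj₁ v) = Adj G u v
  adj (inj₁ _) (inj₂ _) = ⊤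
  adj (inj₂ _) (inj₁ _) = ⊤
  adj (inj₂ u) (inj₂ v) = Adj H u v

  adj-sym : ∀ u v → adj u v → adj v u
  adj-sym (inj₁ _) (inj₁ _) uv = Graph.sym G uv
  adj-sym (inj₁ _) (inj₂ _) _  = tt
  adj-sym (inj₂ _) (inj₁ _) _  = tt
  adj-sym (inj₂ _) (inj₂ _) uv = Graph.sym H uv

  adj-irrefl : ∀ v → ¬ adj v v
  adj-irrefl (inj₁ _) = Graph.irrefl G
  adj-irrefl (inj₂ _) = Graph.irrefl H

Book : ℕ → Graph
Book n = K 2 + n ∙ K 1

-- A map from the edges of G to the t colours.  An edge is an unordered pair,
-- hence the symmetry; the adjacency proof is irrelevant, so the colour depends
-- on the endpoints only, and non-adjacent pairs have no colour at all.
record Colouring (t : ℕ) (G : Graph) : Set where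
  field
    colour : ∀ u v → .(Adj G u v) → Fin t
    symm   : ∀ u v .(uv : Adj G u v) → colour u v uv ≡ colour v u (Graph.sym G uv)

open Colouring public using (colour)

Gallai : ∀ {t G} → Colouring t G → Set
Gallai {G = G} f =
  ∀ x y z (xy : Adj G x y) (xz : Adj G x z) (yz : Adj G y z) →
  ¬ ( colour f x y xy ≢ colour f x z xz
    × colour f x y xy ≢ colour f y z yz
    × colour f x z xz ≢ colour f y z yz )

-- A subgraph of H isomorphic to G, given by the isomorphism onto it.  Only
-- edges are preserved, so the subgraph need not be induced.
record Copy (G H : Graph) : Set where
  field
    map       : Vertex G → Vertex H
    injective : Injective _≡_ _≡_ map
    edge      : ∀ {u v} → Adj G u v → Adj H (map u) (map v)

UsesAtMost : ∀ {t G H} → ℕ → Colouring t H → Copy G H → Set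
UsesAtMost {t} {G} s f φ =
  Σ (Subset t) λ S → ∣ S ∣ ≤ s ×
    (∀ u v (uv : Adj G u v) → colour f (map u) (map v) (edge uv) ∈ S)
  where open Copy φ

Forces : (t s : ℕ) → Graph → ℕ → Set
Forces t s G p =
  (f : Colouring t (K p)) → Gallai f → ∃ λ (φ : Copy G (K p)) → UsesAtMost s f φ

IsLeast : (ℕ → Set) → ℕ → Set
IsLeast P p = P p × (∀ q → P q → p ≤ q)

-- gr t s G ≡ p, as a relation: the number is characterised, not computed.
-- The notion is intended for 1 ≤ s < t.
gr[_,_,_]≡_ : (t s : ℕ) → Graph → ℕ → Set
gr[ t , s , G ]≡ p = IsLeast (Forces t s G) p

{-# OPTIONS --safe #-}
module Submission where

-- A three-coloured K₁₉ without the book has, for every c-edge xy and colour e ≠ c, at least seven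
-- vertices z with an e-edge to x or y.  By Gallai some colour c is disconnected, and its components
-- are joined monochromatically.  Two or three components give a monochromatic cut, which is refuted
-- on the side with at most nine vertices.  Otherwise all vertices outside one component
-- have c-degree at least four, so there are exactly four components, and no sizes with sum 19 leave
-- enough edges of both remaining colours at each of the three large ones.  For K₁₈, join two
-- Paley colourings of K₉.

-- Seven complements ten pages: of the 17 vertices besides `x` and `y`, at most ten avoid `e`. If
-- all edges leaving a set have one colour, an edge of another colour inside it finds its seven
-- vertices of the third colour inside too. The set then has at least nine vertices, which is
-- exactly the most that the smaller side of a cut of 19 can have. The ends of an edge between two
-- components of `c` have c-degrees of sum at least seven, so all vertices of c-degree at most three
-- lie in a single component. Every other component has at least five vertices, and four such
-- components with one further vertex would need 21. Two or three components reduce to a cut because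
-- only two colours run between components: among three pairs two agree, and these meet in a
-- component joined to all the rest in one colour.

open import Defs hiding (_+_; _∙_)

open import Data.Bool.Base using (Bool; true; false; not; _∨_; if_then_else_)
open import Data.Bool.Properties using () renaming (_≟_ to _≟ᵇ_)
open import Data.Empty using (⊥; ⊥-elim)
open import Data.Fin.Base using (Fin; zero; suc; inject≤; remQuot)
open import Data.Fin.Patterns using (0F; 1F; 2F)
open import Data.Fin.Properties using (_≟_; any?; all?; ¬∀⟶∃¬; suc-injective; inject≤-injective)
open import Data.Fin.Subset using (Subset; _∈_; _∉_; ∁; ⁅_⁆; ∣_∣)
open import Data.Fin.Subset.Properties using (x∉p⇒x∈∁p; x∈⁅y⁆⇒x≡y; ∣∁p∣≡n∸∣p∣; ∣⁅x⁆∣≡1)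
open import Data.Nat.Base using (ℕ; zero; suc; _+_; _∸_; _≤_; _<_; z≤n; s≤s; s≤s⁻¹)
open import Data.Nat.Properties
  using (≤-trans; ≤-reflexive; ≤-antisym; ≮⇒≥; ≰⇒>; 1+n≰n; m≤n+m; m≤m+n; n≤1+n; +-mono-≤; +-monoʳ-≤; +-monoˡ-≤; +-cancelˡ-≤; +-cancelʳ-≤; +-cancelˡ-≡; +-suc; +-comm; +-assoc; m+[n∸m]≡n; m+n∸m≡n; allUpTo?; _≤?_; _<?_; module ≤-Reasoning)
  renaming (_≟_ to _≟ⁿ_; suc-injective to ℕ-suc-injective)
open import Data.Nat.Solver using (module +-*-Solver)
open import Data.Product.Base using (∃; ∃₂; _×_; _,_; proj₁; proj₂; map₂)
open import Data.Sum.Base using (_⊎_; inj₁; inj₂; [_,_]′)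
open import Data.Unit.Base using (tt)
open import Data.Vec.Base using ([]; _∷_; there)
open import Function.Base using (_∘_; id; case_of_)
open import Function.Definitions using (Injective)
open import Level using (0ℓ)
open import Relation.Binary.Construct.Closure.ReflexiveTransitive using (Star; ε; _◅_; _◅◅_; gmap; reverse)
open import Relation.Binary.Core using (Rel)
open import Relation.Binary.Definitions using (Symmetric) renaming (Decidable to Decidable₂)
open import Relation.Binary.PropositionalEquality.Core using (_≡_; _≢_; refl; sym; trans; cong; subst; ≢-sym)
open import Relation.Nullary.Decidable using (Dec; yes; no; does; map′; _×-dec_; _⊎-dec_; _→-dec_; ¬?; decidable-stable; dec-true; dec-false; toSum; toWitness)
open import Relation.Nullary.Negation using (¬_; contradiction)
open import Relation.Unary using (Pred; Decidable; _⊆_)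
open import Relation.Unary.Properties using (_∪?_; _∩?_; U?; ∁?)

open +-*-Solver using (solve; _:+_; _:=_; con)

private
  variable
    n m k : ℕ
    P Q R : Pred (Fin n) 0ℓ

-- Counting

-- Opaque (like components), because conversion checking at size 19 would unfold it.
opaque

  count : Decidable {A = Fin n} P → ℕ
  count {zero}  P? = 0
  count {suc n} P? = (if does (P? zero) then 1 else 0) + count (P? ∘ suc)

  count-mono : (P? : Decidable P) (Q? : Decidable Q) → P ⊆ Q → count {n} P? ≤ count Q?
  count-mono {n = zero}  P? Q? P⊆Q = z≤n
  count-mono {n = suc n} P? Q? P⊆Q with P? zero | Q? zero | count-mono (P? ∘ suc) (Q? ∘ suc) P⊆Q
  ... | yes _ | yes _ | ih = s≤s ih
  ... | yes p | no ¬q | ih = contradiction (P⊆Q p) ¬q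
  ... | no _  | yes _ | ih = ≤-trans ih (n≤1+n _)
  ... | no _  | no _  | ih = ih

  count-∪-≤ : (P? : Decidable P) (Q? : Decidable Q) → count {n} (P? ∪? Q?) ≤ count P? + count Q?
  count-∪-≤ {n = zero}  P? Q? = z≤n
  count-∪-≤ {n = suc n} P? Q? with P? zero | Q? zero | count-∪-≤ (P? ∘ suc) (Q? ∘ suc)
  ... | yes _ | yes _ | ih = s≤s (≤-trans ih (+-monoʳ-≤ (count (P? ∘ suc)) (n≤1+n _)))
  ... | yes _ | no _  | ih = s≤s ih
  ... | no _  | yes _ | ih = ≤-trans (s≤s ih) (≤-reflexive (sym (+-suc (count (P? ∘ suc)) _)))
  ... | no _  | no _  | ih = ih

  count-∪-disjoint : (P? : Decidable P) (Q? : Decidable Q) → (∀ {z} → P z → ¬ Q z) →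
                     count {n} P? + count Q? ≤ count (P? ∪? Q?)
  count-∪-disjoint {n = zero}  P? Q? P∩Q=∅ = z≤n
  count-∪-disjoint {n = suc n} P? Q? P∩Q=∅
    with P? zero | Q? zero | count-∪-disjoint (P? ∘ suc) (Q? ∘ suc) P∩Q=∅
  ... | yes p | yes q | ih = contradiction q (P∩Q=∅ p)
  ... | yes _ | no _  | ih = s≤s ih
  ... | no _  | yes _ | ih = ≤-trans (≤-reflexive (+-suc (count (P? ∘ suc)) _)) (s≤s ih)
  ... | no _  | no _  | ih = ih

  count-empty : (P? : Decidable P) → (∀ z → ¬ P z) → count {n} P? ≡ 0
  count-empty {n = zero}  P? P=∅ = refl
  count-empty {n = suc n} P? P=∅ with P? zero
  ... | yes p = contradiction p (P=∅ zero)
  ... | no _  = count-empty (P? ∘ suc) (P=∅ ∘ suc)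

  count-U : ∀ n → count {n} U? ≡ n
  count-U zero    = refl
  count-U (suc n) = cong suc (count-U n)

  count-singleton : (x : Fin n) → count (_≟ x) ≡ 1
  count-singleton {n = suc n} zero    = cong suc (count-empty {n = n} (λ i → suc i ≟ zero) λ _ ())
  count-singleton (suc x) = trans
    (≤-antisym (count-mono (λ i → suc i ≟ suc x) (_≟ x) suc-injective)
               (count-mono (_≟ x) (λ i → suc i ≟ suc x) (cong suc)))
    (count-singleton x)

  count>0⇒∃ : (P? : Decidable P) → 0 < count {n} P? → ∃ P
  count>0⇒∃ P? 0<#P with any? P?
  ... | yes p = p
  ... | no ¬p = contradiction (subst (0 <_) (count-empty P? λ z p → ¬p (z , p)) 0<#P) λ ()

count-cover : (P? : Decidable P) (Q? : Decidable Q) (R? : Decidable R) →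
              (∀ {z} → R z → P z ⊎ Q z) → count {n} R? ≤ count P? + count Q?
count-cover P? Q? R? R⊆P∪Q = ≤-trans (count-mono R? (P? ∪? Q?) R⊆P∪Q) (count-∪-≤ P? Q?)

count-pack : (P? : Decidable P) (Q? : Decidable Q) (R? : Decidable R) →
             P ⊆ R → Q ⊆ R → (∀ {z} → P z → ¬ Q z) → count {n} P? + count Q? ≤ count R?
count-pack P? Q? R? P⊆R Q⊆R P∩Q=∅ =
  ≤-trans (count-∪-disjoint P? Q? P∩Q=∅) (count-mono (P? ∪? Q?) R? [ P⊆R , Q⊆R ]′)

count≤n : (P? : Decidable P) → count {n} P? ≤ n
count≤n P? = ≤-trans (count-mono P? U? _) (≤-reflexive (count-U _))

count-insert : (P? : Decidable P) (R? : Decidable R) {x : Fin n} →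
               R x → P ⊆ R → ¬ P x → suc (count P?) ≤ count R?
count-insert P? R? {x} Rx P⊆R ¬Px = subst (λ s → s + count P? ≤ count R?) (count-singleton x)
  (count-pack (_≟ x) P? R? (λ { refl → Rx }) P⊆R λ { refl → ¬Px })

count-delete : (P? : Decidable P) (R? : Decidable R) (x : Fin n) →
               (∀ {z} → R z → z ≡ x ⊎ P z) → count R? ≤ suc (count P?)
count-delete P? R? x R⊆x∪P = subst (λ s → count R? ≤ s + count P?) (count-singleton x)
  (count-cover (_≟ x) P? R? R⊆x∪P)

choose : (P? : Decidable P) → k ≤ count {n} P? →
         ∃ λ (h : Fin k → Fin n) → Injective _≡_ _≡_ h × (∀ i → P (h i))
choose {k = zero}  P? _ = (λ ()) , (λ { {()} }) , λ ()
choose {P = P} {k = suc k} P? k<#P = h , h-injective , Ph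
  where
  x = proj₁ (count>0⇒∃ P? (≤-trans (s≤s z≤n) k<#P))
  Px = proj₂ (count>0⇒∃ P? (≤-trans (s≤s z≤n) k<#P))
  P∖x? = P? ∩? (λ z → ¬? (z ≟ x))
  split : ∀ {z} → P z → z ≡ x ⊎ (P z × z ≢ x)
  split {z} Pz with z ≟ x
  ... | yes z≡x = inj₁ z≡x
  ... | no  z≢x = inj₂ (Pz , z≢x)
  rest = choose P∖x? (s≤s⁻¹ (≤-trans k<#P (count-delete P∖x? P? x split)))
  h : Fin (suc k) → Fin _
  h zero    = x
  h (suc i) = proj₁ rest i
  Ph : ∀ i → P (h i)
  Ph zero    = Px
  Ph (suc i) = proj₁ (proj₂ (proj₂ rest) i)
  h-injective : Injective _≡_ _≡_ h
  h-injective {zero}  {zero}  eq = refl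
  h-injective {zero}  {suc j} eq = contradiction (sym eq) (proj₂ (proj₂ (proj₂ rest) j))
  h-injective {suc i} {zero}  eq = contradiction eq (proj₂ (proj₂ (proj₂ rest) i))
  h-injective {suc i} {suc j} eq = cong suc (proj₁ (proj₂ rest) eq)

injective⇒≤count : (P? : Decidable P) (h : Fin k → Fin n) → Injective _≡_ _≡_ h →
                   (∀ i → P (h i)) → k ≤ count P?
injective⇒≤count {k = zero}  P? h h-injective Ph = z≤n
injective⇒≤count {k = suc k} P? h h-injective Ph = ≤-trans
  (s≤s (injective⇒≤count (P? ∩? λ z → ¬? (z ≟ h zero)) (h ∘ suc) (suc-injective ∘ h-injective)
          λ i → Ph (suc i) , λ eq → case h-injective eq of λ ()))
  (count-insert (P? ∩? λ z → ¬? (z ≟ h zero)) P? (Ph zero) proj₁ λ p → proj₂ p refl)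

count-∪-∩ : (P? : Decidable P) (Q? : Decidable Q) → count {n} (P? ∪? Q?) + count (P? ∩? Q?) ≤ count P? + count Q?
count-∪-∩ P? Q? = begin
  count (P? ∪? Q?) + count (P? ∩? Q?)                 ≤⟨ +-monoˡ-≤ (count (P? ∩? Q?)) (count-cover P? Q∖P? (P? ∪? Q?) split) ⟩
  (count P? + count Q∖P?) + count (P? ∩? Q?)          ≡⟨ +-assoc (count P?) (count Q∖P?) (count (P? ∩? Q?)) ⟩
  count P? + (count Q∖P? + count (P? ∩? Q?))          ≤⟨ +-monoʳ-≤ (count P?) (count-pack Q∖P? (P? ∩? Q?) Q? proj₁ proj₂ λ q∖p pq → proj₂ q∖p (proj₁ pq)) ⟩
  count P? + count Q?                                 ∎
  where
  open ≤-Reasoning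
  Q∖P? = Q? ∩? ∁? P?
  split : ∀ {z} → _ ⊎ _ → _
  split (inj₁ p) = inj₁ p
  split {z} (inj₂ q) with P? z
  ... | yes p = inj₁ p
  ... | no ¬p = inj₂ (q , ¬p)

all-or-exception : (P? : Decidable P) → (∀ z → P z) ⊎ ∃ {A = Fin n} (λ z → ¬ P z)
all-or-exception P? with all? P?
... | yes ∀P = inj₁ ∀P
... | no ¬∀P = inj₂ (¬∀⟶∃¬ _ _ P? ¬∀P)

-- Connected components

-- Components are recorded by labels, equal exactly on vertices joined by a path.
record Components {n} (_~_ : Rel (Fin n) 0ℓ) : Set where
  field
    label  : Fin n → ℕ
    joined : ∀ {x y} → x ~ y → label x ≡ label y
    path   : ∀ {x y} → label x ≡ label y → Star _~_ x y

opaque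

  components : {_~_ : Rel (Fin n) 0ℓ} → Decidable₂ _~_ → Symmetric _~_ → Components _~_
  components {zero}  _~?_ ~-sym = record { label = λ () ; joined = λ { {()} } ; path = λ { {()} } }
  components {suc n} {_~_} _~?_ ~-sym = record { label = label ; joined = joined ; path = path }
    where
    module C = Components (components (λ x y → suc x ~? suc y) ~-sym)

    Touched : Pred (Fin n) 0ℓ
    Touched i = ∃ λ j → C.label j ≡ C.label i × zero ~ suc j

    touched? : Decidable Touched
    touched? i = any? λ j → (C.label j ≟ⁿ C.label i) ×-dec (zero ~? suc j)

    label : Fin (suc n) → ℕ
    label zero    = 0
    label (suc i) = if does (touched? i) then 0 else suc (C.label i)

    joined : ∀ {x y} → x ~ y → label x ≡ label y
    joined {zero}  {zero}  _ = refl
    joined {zero}  {suc j} r with touched? j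
    ... | yes _ = refl
    ... | no ¬t = contradiction (j , refl , r) ¬t
    joined {suc i} {zero}  r with touched? i
    ... | yes _ = refl
    ... | no ¬t = contradiction (i , refl , ~-sym r) ¬t
    joined {suc i} {suc j} r with touched? i | touched? j
    ... | yes _ | yes _ = refl
    ... | yes (l , eq , s) | no ¬t = contradiction (l , trans eq (C.joined r) , s) ¬t
    ... | no ¬t | yes (l , eq , s) = contradiction (l , trans eq (sym (C.joined r)) , s) ¬t
    ... | no _ | no _ = cong suc (C.joined r)

    from-zero : ∀ {i} → Touched i → Star _~_ zero (suc i)
    from-zero (j , eq , r) = r ◅ gmap suc id (C.path eq)

    path : ∀ {x y} → label x ≡ label y → Star _~_ x y
    path {zero}  {zero}  _ = ε
    path {zero}  {suc j} eq with touched? j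
    ... | yes t = from-zero t
    path {suc i} {zero}  eq with touched? i
    ... | yes t = reverse ~-sym (from-zero t)
    path {suc i} {suc j} eq with touched? i | touched? j
    ... | yes t | yes t′ = reverse ~-sym (from-zero t) ◅◅ from-zero t′
    ... | no _  | no _   = gmap suc id (C.path (ℕ-suc-injective eq))

star-invariant : {_~_ : Rel (Fin n) 0ℓ} → (∀ {x y} → x ~ y → P x → P y) → ∀ {x y} → Star _~_ x y → P x → P y
star-invariant inv ε        p = p
star-invariant inv (r ◅ rs) p = star-invariant inv rs (inv r p)

-- Colours

-- The colours stay variables, so one argument serves every assignment of roles, and `swap₁₂` and
-- `swap₂₃` supply the symmetric cases.
record Palette (a b c : Fin 3) : Set where
  constructor palette
  field
    a≢b : a ≢ b
    a≢c : a ≢ c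
    b≢c : b ≢ c

swap₁₂ : ∀ {a b c} → Palette a b c → Palette b a c
swap₁₂ (palette a≢b a≢c b≢c) = palette (≢-sym a≢b) b≢c a≢c

swap₂₃ : ∀ {a b c} → Palette a b c → Palette a c b
swap₂₃ (palette a≢b a≢c b≢c) = palette a≢c a≢b (≢-sym b≢c)

other-colours : ∀ a → ∃₂ λ b c → Palette a b c
other-colours 0F = 1F , 2F , palette (λ ()) (λ ()) λ ()
other-colours 1F = 0F , 2F , palette (λ ()) (λ ()) λ ()
other-colours 2F = 0F , 1F , palette (λ ()) (λ ()) λ ()

palette-complete : ∀ {a b c} → Palette a b c → ∀ d → d ≡ a ⊎ d ≡ b ⊎ d ≡ c
palette-complete {a} {b} {c} (palette a≢b a≢c b≢c) d = toWitness {a? = all-palettes?} tt a b c d a≢b a≢c b≢c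
  where
  all-palettes? : Dec (∀ (a b c d : Fin 3) → a ≢ b → a ≢ c → b ≢ c → d ≡ a ⊎ d ≡ b ⊎ d ≡ c)
  all-palettes? = all? λ a → all? λ b → all? λ c → all? λ d →
    ¬? (a ≟ b) →-dec (¬? (a ≟ c) →-dec (¬? (b ≟ c) →-dec
    ((d ≟ a) ⊎-dec ((d ≟ b) ⊎-dec (d ≟ c)))))

-- Bundling `x ≢ y` gives an irreflexive relation on all pairs, so neighbourhoods can be counted
-- over the whole of `Fin n`.
E : Colouring 3 (K n) → Fin 3 → Rel (Fin n) 0ℓ
E f c x y = ∃ λ (x≢y : x ≢ y) → colour f x y x≢y ≡ c

pullback : (ι : Fin m → Fin n) → Injective _≡_ _≡_ ι → Colouring 3 (K n) → Colouring 3 (K m)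
pullback ι ι-injective f = record
  { colour = λ u v u≢v → colour f (ι u) (ι v) (λ eq → u≢v (ι-injective eq))
  ; symm   = λ u v u≢v → Colouring.symm f (ι u) (ι v) (λ eq → u≢v (ι-injective eq))
  }

pullback-Gallai : (ι : Fin m → Fin n) (ι-injective : Injective _≡_ _≡_ ι) (f : Colouring 3 (K n)) →
                  Gallai f → Gallai (pullback ι ι-injective f)
pullback-Gallai ι ι-injective f gallai x y z xy xz yz =
  gallai (ι x) (ι y) (ι z) (xy ∘ ι-injective) (xz ∘ ι-injective) (yz ∘ ι-injective)

module GallaiColouring (f : Colouring 3 (K n)) (gallai : Gallai f) where

  E? : ∀ c → Decidable₂ (E f c)
  E? c x y with x ≟ y
  ... | yes x≡y = no λ e → proj₁ e x≡y
  ... | no  x≢y = map′ (x≢y ,_) proj₂ (colour f x y x≢y ≟ c)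

  deg : Fin 3 → Fin n → ℕ
  deg c x = count (E? c x)

  E-sym : ∀ {c} → Symmetric (E f c)
  E-sym (x≢y , eq) = ≢-sym x≢y , trans (sym (Colouring.symm f _ _ x≢y)) eq

  E-unique : ∀ {c d x y} → E f c x y → E f d x y → c ≡ d
  E-unique (_ , eq) (_ , eq′) = trans (sym eq) eq′

  E-total : ∀ {a b c x y} → Palette a b c → x ≢ y → E f a x y ⊎ E f b x y ⊎ E f c x y
  E-total {x = x} {y} pal x≢y with palette-complete pal (colour f x y x≢y)
  ... | inj₁ eq        = inj₁ (x≢y , eq)
  ... | inj₂ (inj₁ eq) = inj₂ (inj₁ (x≢y , eq))
  ... | inj₂ (inj₂ eq) = inj₂ (inj₂ (x≢y , eq))

  third-edge : ∀ {a b x y z} → a ≢ b → E f a x y → E f b x z → E f a y z ⊎ E f b y z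
  third-edge {a} {b} {x} {y} {z} a≢b xy@(x≢y , refl) xz@(x≢z , refl) = edge (λ { refl → a≢b (E-unique xy xz) })
    where
    edge : y ≢ z → E f a y z ⊎ E f b y z
    edge y≢z with colour f y z y≢z ≟ a | colour f y z y≢z ≟ b
    ... | yes eq | _      = inj₁ (y≢z , eq)
    ... | no _   | yes eq = inj₂ (y≢z , eq)
    ... | no ≢a  | no ≢b  = contradiction (a≢b , ≢-sym ≢a , ≢-sym ≢b) (gallai x y z x≢y x≢z y≢z)

  module Component (c : Fin 3) where
    open Components (components (E? c) E-sym) public

    -- For a c-edge `xm`, the edge `ym` cannot have colour `c` because `y` lies in another
    -- component; as the triangle is not rainbow, `ym` repeats the colour of `xy`.
    homogeneousˡ : ∀ {a x x′ y} → Star (E f c) x x′ → label x ≢ label y → E f a x y → E f a x′ y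
    homogeneousˡ ε x≁y xy = xy
    homogeneousˡ {a} (xm ◅ mx′) x≁y xy = homogeneousˡ mx′ (x≁y ∘ trans (joined xm))
      (case third-edge a≢c xy xm of λ
        { (inj₁ ym) → E-sym ym
        ; (inj₂ ym) → contradiction (trans (joined xm) (sym (joined ym))) x≁y })
      where
      a≢c : a ≢ c
      a≢c refl = x≁y (joined xy)

    homogeneous : ∀ {a x x′ y y′} → label x ≡ label x′ → label y ≡ label y′ → label x ≢ label y →
                  E f a x y → E f a x′ y′
    homogeneous x∼x′ y∼y′ x≁y xy =
      E-sym (homogeneousˡ (path y∼y′) (λ y∼x′ → x≁y (trans x∼x′ (sym y∼x′)))
        (E-sym (homogeneousˡ (path x∼x′) x≁y xy)))

-- Gallai's theorem: some colour is disconnected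

isolated : {_~_ : Rel (Fin n) 0ℓ} → ∀ {x y} → (∀ z → ¬ (x ~ z)) → x ≢ y → ¬ Star _~_ x y
isolated ¬x~ x≢y ε       = x≢y refl
isolated ¬x~ x≢y (r ◅ _) = ¬x~ _ r

Disconnected : Colouring 3 (K n) → Set
Disconnected f = ∃ λ c → ∃₂ λ x y → ¬ Star (E f c) x y

-- Gallai's theorem, by removing the vertex zero.  If it sends a c-edge to every c-component of the
-- rest, then an a-edge from it to w forces colour a between the component of w and all the others.
disconnected-extend : (f : Colouring 3 (K (2 + n))) → Gallai f →
                      Disconnected (pullback suc suc-injective f) → Disconnected f
disconnected-extend {n} f gallai (c , x₀ , y₀ , ¬x₀y₀) = step
  where
  open GallaiColouring f gallai
  f′ = pullback suc suc-injective f
  module G′ = GallaiColouring f′ (pullback-Gallai suc suc-injective f gallai)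
  open G′.Component c

  lower : ∀ {c x y} → E f c (suc x) (suc y) → E f′ c x y
  lower (x≢y , eq) = x≢y ∘ cong suc , eq

  x₀≁y₀ : label x₀ ≢ label y₀
  x₀≁y₀ = ¬x₀y₀ ∘ path

  Touched : Pred (Fin (1 + n)) 0ℓ
  Touched u = ∃ λ w → label w ≡ label u × E f c zero (suc w)
  touched? : Decidable Touched
  touched? u = any? λ w → (label w ≟ⁿ label u) ×-dec E? c zero (suc w)

  untouched : ∀ u → ¬ Touched u → Disconnected f
  untouched u ¬t = c , suc u , zero , λ s → star-invariant inv s refl
    where
    In : Pred (Fin (2 + n)) 0ℓ
    In zero    = ⊥
    In (suc z) = label z ≡ label u
    inv : ∀ {x y} → E f c x y → In x → In y
    inv {suc x} {zero}  e x∼u = ¬t (x , x∼u , E-sym e)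
    inv {suc x} {suc y} e x∼u = trans (sym (joined (lower e))) x∼u

  module _ (touched : ∀ u → Touched u) where
    -- A c-edge from vertex zero into the component of `z` ends at some `u`. The triangle on zero,
    -- `w`, `u` leaves `a` or `c` for `wu`, and `c` would merge two components.
    outside : ∀ {a w} → a ≢ c → E f a zero (suc w) → ∀ z → label w ≢ label z → E f′ a w z
    outside {a} {w} a≢c vw z w≁z with touched z
    ... | u , u∼z , vu with third-edge a≢c vw vu
    ...   | inj₁ wu = homogeneous refl u∼z (λ w∼u → w≁z (trans w∼u u∼z)) (lower wu)
    ...   | inj₂ wu = contradiction (trans (joined (lower wu)) u∼z) w≁z

    -- If `w` and `w′` lie in different components, the edge between them would have both colours.
    -- If they share one, any vertex outside it would be joined to it in both colours, and one of
    -- `x₀`, `y₀` is outside.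
    clash : ∀ {a b w w′} → a ≢ c → b ≢ c → a ≢ b → E f a zero (suc w) → ¬ E f b zero (suc w′)
    clash {a} {b} {w} {w′} a≢c b≢c a≢b vw vw′ with label w ≟ⁿ label w′
    ... | no w≁w′ = a≢b (G′.E-unique (outside a≢c vw w′ w≁w′)
                                     (G′.E-sym (outside b≢c vw′ w (w≁w′ ∘ sym))))
    ... | yes w∼w′ = case label w ≟ⁿ label x₀ of λ
      { (no w≁x₀)  → at x₀ w≁x₀
      ; (yes w∼x₀) → at y₀ (λ w∼y₀ → x₀≁y₀ (trans (sym w∼x₀) w∼y₀)) }
      where
      at : ∀ z → label w ≢ label z → ⊥
      at z w≁z = a≢b (G′.E-unique
        (homogeneous w∼w′ refl w≁z (outside a≢c vw z w≁z))
        (outside b≢c vw′ z (w≁z ∘ trans w∼w′)))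

  step : Disconnected f
  step with all? touched?
  ... | no ¬∀ = case ¬∀⟶∃¬ _ Touched touched? ¬∀ of λ (u , ¬t) → untouched u ¬t
  ... | yes touched with other-colours c
  ...   | a , b , palette c≢a c≢b a≢b with any? (E? a zero) | any? (E? b zero)
  -- A colour absent at vertex zero isolates it; by `clash`, `a` and `b` are not both present.
  ...     | no ¬a | _ = a , zero , suc zero , isolated (λ z e → ¬a (z , e)) λ ()
  ...     | yes _ | no ¬b = b , zero , suc zero , isolated (λ z e → ¬b (z , e)) λ ()
  ...     | yes (zero , e) | _ = contradiction refl (proj₁ e)
  ...     | yes (suc w , _) | yes (zero , e) = contradiction refl (proj₁ e)
  ...     | yes (suc w , e) | yes (suc w′ , e′) =
            contradiction e′ (clash touched (≢-sym c≢a) (≢-sym c≢b) a≢b e)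

gallai-disconnected : ∀ n (f : Colouring 3 (K (2 + n))) → Gallai f → Disconnected f
gallai-disconnected zero f gallai with colour f 0F 1F (λ ()) in eq
... | 0F = 1F , 0F , 1F , isolated (λ { 0F e → proj₁ e refl ; 1F e → case trans (sym eq) (proj₂ e) of λ () }) λ ()
... | 1F = 0F , 0F , 1F , isolated (λ { 0F e → proj₁ e refl ; 1F e → case trans (sym eq) (proj₂ e) of λ () }) λ ()
... | 2F = 0F , 0F , 1F , isolated (λ { 0F e → proj₁ e refl ; 1F e → case trans (sym eq) (proj₂ e) of λ () }) λ ()
gallai-disconnected (suc n) f gallai = disconnected-extend f gallai
  (gallai-disconnected n (pullback suc suc-injective f) (pullback-Gallai suc suc-injective f gallai))

-- Arithmetic of the sizes of four classes

weight : Bool → ℕ → ℕ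
weight β k = if β then k else 0

-- A class of size p is joined to classes of sizes q, r, s, in colour a where the flag is true and in
-- colour b where it is false.  A c-edge inside the class, whose ends have c-degree at least 4, meets at
-- most 2 (p − 5) edges of a given other colour there and needs 7, whence 17.
record Rich (p : ℕ) (β : Bool) (q : ℕ) (γ : Bool) (r : ℕ) (δ : Bool) (s : ℕ) : Set where
  constructor _&_
  field
    first  : 17 ≤ (p + p) + (weight β q + (weight γ r + weight δ s))
    second : 17 ≤ (p + p) + (weight (not β) q + (weight (not γ) r + weight (not δ) s))

rich? : ∀ p β q γ r δ s → Dec (Rich p β q γ r δ s)
rich? p β q γ r δ s = map′ (λ (x , y) → x & y) (λ (x & y) → x , y) ((17 ≤? _) ×-dec (17 ≤? _))

all-bool? : {P : Bool → Set} → Decidable P → Dec (∀ β → P β)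
all-bool? P? = map′ (λ { (t , f) true → t ; (t , f) false → f }) (λ h → h true , h false) (P? true ×-dec P? false)

-- The large sizes are 5 plus an excess, and the fourth size is what remains of 19 = 15 + 4. As it
-- is positive, only finitely many excesses occur; each of the six pairs of classes has one flag.
NoRich : ℕ → ℕ → ℕ → Set
NoRich i j k = i + (j + k) < 4 → ∀ pq pr ps qr qs rs →
  let p = 5 + i ; q = 5 + j ; r = 5 + k ; s = 4 ∸ (i + (j + k)) in
  ¬ (Rich p pq q pr r ps s × Rich q pq p qr r qs s × Rich r pr p qr q rs s)

noRich? : ∀ i j k → Dec (NoRich i j k)
noRich? i j k = (i + (j + k) <? 4) →-dec
  all-bool? λ pq → all-bool? λ pr → all-bool? λ ps → all-bool? λ qr → all-bool? λ qs → all-bool? λ rs →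
  ¬? (rich? _ pq _ pr _ ps _ ×-dec (rich? _ pq _ qr _ qs _ ×-dec rich? _ pr _ qr _ rs _))

-- The finite check has a reason behind it. If the class of size `p` is joined to both other large
-- classes in one colour, the other colour has only `s`, and 2p + s = 14 + i - j - k reaches 17 only
-- for the sizes 8, 5, 5, 1. There a class of size 5 needs 7 in each colour, but no part of 8, 5, 1
-- sums to 7. Otherwise each large class sees the other two in different colours, impossible for two
-- colours on a triangle.
noRich : ∀ {i} → i < 4 → ∀ {j} → j < 4 → ∀ {k} → k < 4 → NoRich i j k
noRich = toWitness {a? = allUpTo? (λ i → allUpTo? (λ j → allUpTo? (λ k → noRich? i j k) 4) 4) 4} tt

no-rich-sizes : ∀ {p q r s pq pr ps qr qs rs} → 5 ≤ p → 5 ≤ q → 5 ≤ r → 1 ≤ s → p + (q + (r + s)) ≡ 19 →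
                Rich p pq q pr r ps s → Rich q pq p qr r qs s → ¬ Rich r pr p qr q rs s
no-rich-sizes {p} {q} {r} {s} 5≤p 5≤q 5≤r 1≤s total = go (m+[n∸m]≡n 5≤p) (m+[n∸m]≡n 5≤q) (m+[n∸m]≡n 5≤r)
  where
  go : ∀ {i j k pq pr ps qr qs rs} → 5 + i ≡ p → 5 + j ≡ q → 5 + k ≡ r →
       Rich p pq q pr r ps s → Rich q pq p qr r qs s → ¬ Rich r pr p qr q rs s
  go {i} {j} {k} refl refl refl P Q R =
    noRich (≤-trans (s≤s (m≤m+n i (j + k))) sum<4) (≤-trans (s≤s (≤-trans (m≤m+n j k) (m≤n+m (j + k) i))) sum<4)
      (≤-trans (s≤s (≤-trans (m≤n+m k j) (m≤n+m (j + k) i))) sum<4) sum<4 _ _ _ _ _ _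
      (subst (λ s → Rich _ _ _ _ _ _ s × Rich _ _ _ _ _ _ s × Rich _ _ _ _ _ _ s) s≡ (P , Q , R))
    where
    sum : (i + (j + k)) + s ≡ 4
    sum = +-cancelˡ-≡ 15 _ _ (trans
      (solve 4 (λ i j k s → con 15 :+ ((i :+ (j :+ k)) :+ s) := (con 5 :+ i) :+ ((con 5 :+ j) :+ ((con 5 :+ k) :+ s))) refl i j k s)
      total)
    sum<4 : i + (j + k) < 4
    sum<4 = subst (suc (i + (j + k)) ≤_) sum
      (≤-trans (≤-reflexive (+-comm 1 (i + (j + k)))) (+-monoʳ-≤ (i + (j + k)) 1≤s))
    s≡ : s ≡ 4 ∸ (i + (j + k))
    s≡ = trans (sym (m+n∸m≡n (i + (j + k)) s)) (cong (_∸ (i + (j + k))) sum)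

-- Colourings of K₁₉ in which every two-coloured book has at most ten pages

module Bookless (f : Colouring 3 (K 19)) (gallai : Gallai f)
  (pages : ∀ {c e x y} → c ≢ e → E f c x y →
           7 ≤ count (GallaiColouring.E? f gallai e x ∪? GallaiColouring.E? f gallai e y))
  where

  open GallaiColouring f gallai

  -- A small side S of a monochromatic cut carries no edge of the other colours b and c: such an
  -- edge leaves no slack in |S| ≤ 9, so S would be {b,c}-coloured without monochromatic triangle.
  module SmallSide {S : Pred (Fin 19) 0ℓ} (S? : Decidable S) {a}
    (cross : ∀ {x y} → S x → ¬ S y → E f a x y) (small : count S? ≤ 9)
    where

    open Palette

    inside : ∀ {b u z} → a ≢ b → S u → E f b u z → S z
    inside a≢b Su uz = decidable-stable (S? _) λ ¬Sz → a≢b (E-unique (cross Su ¬Sz) uz)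

    module _ {b c u v} (pal : Palette a b c) (Su : S u) (Sv : S v) (uv : E f b u v) where

      private
        C? = E? c u ∪? E? c v
        C⊆S : ∀ {z} → E f c u z ⊎ E f c v z → S z
        C⊆S = [ inside (a≢c pal) Su , inside (a≢c pal) Sv ]′
        ¬Cu : ¬ (E f c u u ⊎ E f c v u)
        ¬Cu = [ (λ e → proj₁ e refl) , (λ e → b≢c pal (E-unique (E-sym uv) e)) ]′
        ¬Cv : ¬ (v ≡ u ⊎ E f c u v ⊎ E f c v v)
        ¬Cv = [ proj₁ uv ∘ sym , [ (λ e → b≢c pal (E-unique uv e)) , (λ e → proj₁ e refl) ]′ ]′
        uC? = (_≟ u) ∪? C?
        vuC? = (_≟ v) ∪? uC?
        uC⊆S : ∀ {z} → z ≡ u ⊎ E f c u z ⊎ E f c v z → S z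
        uC⊆S = [ (λ { refl → Su }) , C⊆S ]′
        vuC⊆S : ∀ {z} → z ≡ v ⊎ z ≡ u ⊎ E f c u z ⊎ E f c v z → S z
        vuC⊆S = [ (λ { refl → Sv }) , uC⊆S ]′
        9≤vuC : 9 ≤ count vuC?
        9≤vuC = ≤-trans (s≤s (≤-trans (s≤s (pages (b≢c pal) uv)) (count-insert C? uC? (inj₁ refl) inj₂ ¬Cu)))
                        (count-insert uC? vuC? (inj₁ refl) inj₂ ¬Cv)

      nine : 9 ≤ count S?
      nine = ≤-trans 9≤vuC (count-mono vuC? S? vuC⊆S)

      -- The ends `u`, `v` and the seven vertices with a c-edge to one of them already fill `S`.
      third-colour : ∀ {w} → S w → w ≢ u → w ≢ v → E f c u w ⊎ E f c v w
      third-colour {w} Sw w≢u w≢v = decidable-stable (C? w) λ ¬Cw →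
        1+n≰n (≤-trans (≤-trans (s≤s 9≤vuC) (count-insert vuC? S? Sw vuC⊆S [ w≢v , [ w≢u , ¬Cw ]′ ]′)) small)

    -- By `third-colour` for the edge `xu`, the vertex `v` has a c-edge to `x` or `u`, and `xv` has
    -- colour `b`.
    opposite : ∀ {b c x u v} → Palette a b c → S x → E f b x u → E f b x v → u ≢ v → E f c u v
    opposite pal Sx xu xv u≢v =
      [ (λ xv′ → contradiction (E-unique xv xv′) (b≢c pal)) , id ]′
      (third-colour pal Sx (inside (a≢b pal) Sx xu) xu (inside (a≢b pal) Sx xv) (≢-sym (proj₁ xv)) (≢-sym u≢v))

    -- Three b-neighbours would span a c-triangle by `opposite`, whereas `third-colour` with `b` and
    -- `c` exchanged demands a b-edge in it.
    deg≤2 : ∀ {b c x} → Palette a b c → S x → deg b x ≤ 2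
    deg≤2 {b} {c} {x} pal Sx = ≮⇒≥ λ 3≤deg → case choose (E? b x) 3≤deg of λ (h , h-injective , xh) →
      let hh : ∀ {i j} → i ≢ j → E f c (h i) (h j)
          hh i≢j = opposite pal Sx (xh _) (xh _) (i≢j ∘ h-injective)
          Sh : ∀ i → S (h i)
          Sh i = inside (a≢b pal) Sx (xh i)
      in case third-colour (swap₂₃ pal) (Sh 0F) (Sh 1F) (hh λ ()) (Sh 2F)
                (λ eq → case h-injective eq of λ ()) (λ eq → case h-injective eq of λ ()) of λ
        { (inj₁ e) → b≢c pal (E-unique e (hh λ ()))
        ; (inj₂ e) → b≢c pal (E-unique e (hh λ ())) }

    -- Such an edge would join `x` to every other vertex of `S` in colour `b` or `c`; both degrees
    -- are at most two, while `S` has at least nine vertices.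
    no-other-edge : ∀ {b c x y} → Palette a b c → S x → S y → ¬ E f b x y
    no-other-edge {b} {c} {x} {y} pal Sx Sy xy = contradiction (begin
      9                              ≤⟨ nine pal Sx Sy xy ⟩
      count S?                       ≤⟨ count-delete (E? b x ∪? E? c x) S? x split ⟩
      suc (count (E? b x ∪? E? c x)) ≤⟨ s≤s (count-∪-≤ (E? b x) (E? c x)) ⟩
      suc (deg b x + deg c x)        ≤⟨ s≤s (+-mono-≤ (deg≤2 pal Sx) (deg≤2 (swap₂₃ pal) Sx)) ⟩
      5                              ∎) λ { (s≤s (s≤s (s≤s (s≤s (s≤s ()))))) }
      where
      open ≤-Reasoning
      split : ∀ {z} → S z → z ≡ x ⊎ E f b x z ⊎ E f c x z
      split {z} Sz with z ≟ x | z ≟ y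
      ... | yes z≡x | _        = inj₁ z≡x
      ... | no _    | yes refl = inj₂ (inj₁ xy)
      ... | no z≢x  | no z≢y   = inj₂
        -- If the c-edge of `z` goes to `y`, the triangle with the b-edge `yx` leaves `b` or `c` for
        -- `xz`.
        ([ inj₂ , third-edge (b≢c pal) (E-sym xy) ]′ (third-colour pal Sx Sy xy Sz z≢x z≢y))

    -- Hence S is a single vertex and the a-neighbourhoods in the complement of S form
    -- cliques of order 4.  The b-neighbourhood of y is a union of such cliques, but has order 7.
    module _ {x₀ y₀} (Sx₀ : S x₀) (¬Sy₀ : ¬ S y₀) where

      private
        variable
          b c : Fin 3
          y y′ w z : Fin 19

      -- Apply `pages` to the a-edge `x₀y`: no b-edge is left at `x₀`, so all seven are at `y`.
      7≤deg : Palette a b c → ¬ S y → 7 ≤ deg b y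
      7≤deg {b} {c} {y} pal ¬Sy = ≤-trans (pages (a≢b pal) (cross Sx₀ ¬Sy))
        (count-mono (E? b x₀ ∪? E? b y) (E? b y)
          [ (λ e → contradiction e (no-other-edge pal Sx₀ (inside (a≢b pal) Sx₀ e))) , id ]′)

      deg-sum : Palette a b c → deg a y + (deg b y + deg c y) ≤ 18
      deg-sum {b} {c} {y} pal = s≤s⁻¹ (begin
        suc (deg a y + (deg b y + deg c y)) ≤⟨ s≤s (+-monoʳ-≤ (deg a y) (count-∪-disjoint (E? b y) (E? c y) (λ e e′ → b≢c pal (E-unique e e′)))) ⟩
        suc (deg a y + count bc?)           ≤⟨ s≤s (count-∪-disjoint (E? a y) bc? (λ e → [ (λ e′ → a≢b pal (E-unique e e′)) , (λ e′ → a≢c pal (E-unique e e′)) ]′)) ⟩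
        suc (count abc?)                    ≤⟨ count-insert abc? U? {y} _ _ [ irr , [ irr , irr ]′ ]′ ⟩
        count {19} U?                       ≡⟨ count-U 19 ⟩
        19                                  ∎)
        where
        open ≤-Reasoning
        bc? = E? b y ∪? E? c y
        abc? = E? a y ∪? bc?
        irr : ∀ {d} → ¬ E f d y y
        irr e = proj₁ e refl

      deg≤4 : ¬ S y → deg a y ≤ 4
      deg≤4 {y} ¬Sy with other-colours a
      ... | b , c , pal = +-cancelʳ-≤ 14 (deg a y) 4
        (≤-trans (+-monoʳ-≤ (deg a y) (+-mono-≤ (7≤deg pal ¬Sy) (7≤deg (swap₂₃ pal) ¬Sy))) (deg-sum pal))

      S⊆N : ¬ S y → ∀ {z} → S z → E f a y z
      S⊆N ¬Sy Sz = E-sym (cross Sz ¬Sy)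

      -- Inclusion-exclusion on the a-neighbourhoods, whose union has at least seven vertices. Since
      -- a-degrees outside `S` are at most four, `y` and `y′` share at most one a-neighbour; all of
      -- `S` is shared, so `S` is one vertex and both degrees equal four.
      common : Palette a b c → E f b y y′ → 7 + count (E? a y ∩? E? a y′) ≤ deg a y + deg a y′
      common {b} {c} {y} {y′} pal yy′ = ≤-trans
        (+-monoˡ-≤ (count (E? a y ∩? E? a y′)) (pages (≢-sym (a≢b pal)) yy′))
        (count-∪-∩ (E? a y) (E? a y′))

      neighbour : Palette a b c → ¬ S y → ∃ λ y′ → ¬ S y′ × E f b y y′
      neighbour {b} {c} {y} pal ¬Sy =
        map₂ (λ yy′ → (λ Sy′ → ¬Sy (inside (a≢b pal) Sy′ (E-sym yy′))) , yy′)
             (count>0⇒∃ (E? b y) (≤-trans (s≤s z≤n) (7≤deg pal ¬Sy)))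

      1≤S : 1 ≤ count S?
      1≤S = injective⇒≤count S? (λ (_ : Fin 1) → x₀) (λ { {0F} {0F} _ → refl }) λ _ → Sx₀

      7+S≤ : Palette a b c → ¬ S y → ¬ S y′ → E f b y y′ → 7 + count S? ≤ deg a y + deg a y′
      7+S≤ {y = y} {y′} pal ¬Sy ¬Sy′ yy′ = ≤-trans
        (+-monoʳ-≤ 7 (count-mono S? (E? a y ∩? E? a y′) λ Sz → S⊆N ¬Sy Sz , S⊆N ¬Sy′ Sz))
        (common pal yy′)

      S≤1 : count S? ≤ 1
      S≤1 with other-colours a
      ... | b , c , pal = case neighbour pal ¬Sy₀ of λ (y , ¬Sy , y₀y) →
        +-cancelˡ-≤ 7 (count S?) 1
          (≤-trans (7+S≤ pal ¬Sy₀ ¬Sy y₀y) (+-mono-≤ (deg≤4 ¬Sy₀) (deg≤4 ¬Sy)))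

      4≤deg : ¬ S y → 4 ≤ deg a y
      4≤deg {y} ¬Sy with other-colours a
      ... | b , c , pal = case neighbour pal ¬Sy of λ (y′ , ¬Sy′ , yy′) →
        +-cancelʳ-≤ 4 4 (deg a y)
          (≤-trans (+-monoʳ-≤ 7 1≤S) (≤-trans (7+S≤ pal ¬Sy ¬Sy′ yy′) (+-monoʳ-≤ (deg a y) (deg≤4 ¬Sy′))))

      no-common : Palette a b c → ¬ S y → ¬ S y′ → E f b y y′ → ¬ S w → E f a y w → ¬ E f a y′ w
      no-common {y = y} {y′} pal ¬Sy ¬Sy′ yy′ ¬Sw yw y′w = 1+n≰n (begin
        9                                   ≤⟨ +-monoʳ-≤ 8 1≤S ⟩
        7 + suc (count S?)                  ≤⟨ +-monoʳ-≤ 7 (count-insert S? (E? a y ∩? E? a y′) (yw , y′w) (λ Sz → S⊆N ¬Sy Sz , S⊆N ¬Sy′ Sz) ¬Sw) ⟩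
        7 + count (E? a y ∩? E? a y′)       ≤⟨ common pal yy′ ⟩
        deg a y + deg a y′                  ≤⟨ +-mono-≤ (deg≤4 ¬Sy) (deg≤4 ¬Sy′) ⟩
        8                                   ∎)
        where open ≤-Reasoning

      -- The closed a-neighbourhood outside `S`. By `no-common`, two a-neighbours of `w` outside `S`
      -- are joined in `a`, since otherwise they would share `w`.
      Clique : Fin 19 → Pred (Fin 19) 0ℓ
      Clique w z = z ≡ w ⊎ (E f a w z × ¬ S z)

      clique? : ∀ w → Decidable (Clique w)
      clique? w = (_≟ w) ∪? (E? a w ∩? ∁? S?)

      4≤clique : ¬ S w → 4 ≤ count (clique? w)
      4≤clique {w} ¬Sw = begin
        4                                      ≤⟨ 4≤deg ¬Sw ⟩
        deg a w                                ≤⟨ count-cover S? (E? a w ∩? ∁? S?) (E? a w) split ⟩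
        count S? + count (E? a w ∩? ∁? S?)     ≤⟨ +-monoˡ-≤ (count (E? a w ∩? ∁? S?)) S≤1 ⟩
        suc (count (E? a w ∩? ∁? S?))          ≤⟨ count-insert (E? a w ∩? ∁? S?) (clique? w) (inj₁ refl) inj₂ (λ e → proj₁ (proj₁ e) refl) ⟩
        count (clique? w)                      ∎
        where
        open ≤-Reasoning
        split : E f a w z → S z ⊎ (E f a w z × ¬ S z)
        split {z} e with S? z
        ... | yes Sz = inj₁ Sz
        ... | no ¬Sz = inj₂ (e , ¬Sz)

      clique≤4 : ¬ S w → count (clique? w) ≤ 4
      clique≤4 {w} ¬Sw = begin
        count (clique? w)                      ≤⟨ count-delete (E? a w ∩? ∁? S?) (clique? w) w id ⟩
        1 + count (E? a w ∩? ∁? S?)            ≤⟨ +-monoˡ-≤ (count (E? a w ∩? ∁? S?)) 1≤S ⟩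
        count S? + count (E? a w ∩? ∁? S?)     ≤⟨ count-pack S? (E? a w ∩? ∁? S?) (E? a w) (S⊆N ¬Sw) proj₁ (λ Sz e → proj₂ e Sz) ⟩
        deg a w                                ≤⟨ deg≤4 ¬Sw ⟩
        4                                      ∎
        where open ≤-Reasoning

      -- The triangle on `w`, `z`, `y` leaves `a` or `b` for `zy`; colour `a` would make `z` a
      -- common a-neighbour of `y` and `w` outside `S`.
      clique⊆ : Palette a b c → ¬ S y → ¬ S w → E f b y w → Clique w z → E f b y z
      clique⊆ pal ¬Sy ¬Sw yw (inj₁ refl) = yw
      clique⊆ pal ¬Sy ¬Sw yw (inj₂ (wz , ¬Sz)) =
        [ (λ zy → contradiction wz (no-common pal ¬Sy ¬Sw yw ¬Sz (E-sym zy))) , E-sym ]′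
        (third-edge (a≢b pal) wz (E-sym yw))

      cliques-disjoint : ∀ {w w′} → ¬ S w → ¬ S w′ → ¬ Clique w w′ → Clique w z → ¬ Clique w′ z
      cliques-disjoint ¬Sw ¬Sw′ w≁w′ Kz (inj₁ refl) = w≁w′ Kz
      cliques-disjoint ¬Sw ¬Sw′ w≁w′ (inj₁ refl) (inj₂ (w′w , _)) = w≁w′ (inj₂ (E-sym w′w , ¬Sw′))
      cliques-disjoint ¬Sw ¬Sw′ w≁w′ (inj₂ (wz , ¬Sz)) (inj₂ (w′z , _)) with other-colours a
      ... | b , c , pal = case E-total pal (w≁w′ ∘ inj₁ ∘ sym) of λ
        { (inj₁ ww′)        → w≁w′ (inj₂ (ww′ , ¬Sw′))
        ; (inj₂ (inj₁ ww′)) → no-common pal ¬Sw ¬Sw′ ww′ ¬Sz wz w′z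
        ; (inj₂ (inj₂ ww′)) → no-common (swap₂₃ pal) ¬Sw ¬Sw′ ww′ ¬Sz wz w′z }

      second-clique : Palette a b c → ¬ S y → ¬ S w → ∃ λ w′ → E f b y w′ × ¬ Clique w w′
      second-clique {b} {c} {y} {w} pal ¬Sy ¬Sw = count>0⇒∃ rest? (+-cancelˡ-≤ 4 1 (count rest?) (begin
        5                               ≤⟨ m≤n+m 5 2 ⟩
        7                               ≤⟨ 7≤deg pal ¬Sy ⟩
        deg b y                         ≤⟨ count-cover (clique? w) rest? (E? b y) split ⟩
        count (clique? w) + count rest? ≤⟨ +-monoˡ-≤ (count rest?) (clique≤4 ¬Sw) ⟩
        4 + count rest?                 ∎))
        where
        open ≤-Reasoning
        rest? = E? b y ∩? ∁? (clique? w)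
        split : E f b y z → Clique w z ⊎ (E f b y z × ¬ Clique w z)
        split {z} e with clique? w z
        ... | yes Kz = inj₁ Kz
        ... | no ¬Kz = inj₂ (e , ¬Kz)

      -- Seven b-neighbours do not fit into one clique of order 4, so two disjoint cliques lie in
      -- the b-neighbourhood.
      8≤deg : Palette a b c → ¬ S y → 8 ≤ deg b y
      8≤deg {b} {c} {y} pal ¬Sy =
        case neighbour pal ¬Sy of λ (w , ¬Sw , yw) →
        case second-clique pal ¬Sy ¬Sw of λ (w′ , yw′ , w≁w′) →
        let ¬Sw′ = λ Sw′ → ¬Sy (inside (a≢b pal) Sw′ (E-sym yw′)) in
        ≤-trans (+-mono-≤ (4≤clique ¬Sw) (4≤clique ¬Sw′))
          (count-pack (clique? w) (clique? w′) (E? b y)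
            (clique⊆ pal ¬Sy ¬Sw yw) (clique⊆ pal ¬Sy ¬Sw′ yw′) (cliques-disjoint ¬Sw ¬Sw′ w≁w′))

      absurd : ⊥
      absurd with other-colours a
      ... | b , c , pal = 1+n≰n (begin
        19                                   ≤⟨ +-mono-≤ (4≤deg ¬Sy₀) (+-mono-≤ (8≤deg pal ¬Sy₀) (7≤deg (swap₂₃ pal) ¬Sy₀)) ⟩
        deg a y₀ + (deg b y₀ + deg c y₀)     ≤⟨ deg-sum pal ⟩
        18                                   ∎)
        where open ≤-Reasoning

  no-monochromatic-cut : {S : Pred (Fin 19) 0ℓ} → Decidable S → ∀ {a x₀ y₀} →
                         (∀ {x y} → S x → ¬ S y → E f a x y) → S x₀ → ¬ ¬ S y₀
  no-monochromatic-cut S? {a} cross Sx₀ ¬Sy₀ with count S? ≤? 9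
  ... | yes small = SmallSide.absurd S? cross small Sx₀ ¬Sy₀
  ... | no large = SmallSide.absurd (∁? S?)
    (λ ¬Sx ¬¬Sy → E-sym (cross (decidable-stable (S? _) ¬¬Sy) ¬Sx))
    (+-cancelˡ-≤ 10 (count (∁? S?)) 9 (≤-trans (+-monoˡ-≤ (count (∁? S?)) (≰⇒> large))
      (≤-trans (count-∪-disjoint S? (∁? S?) (λ p ¬p → ¬p p)) (count≤n (S? ∪? ∁? S?)))))
    ¬Sy₀ (λ ¬Sx₀ → ¬Sx₀ Sx₀)

  -- The components of a disconnected colour c

  module Classes {a b c} (pal : Palette a b c) where
    open Palette pal
    open Component c

    infix 4 _∼_ _≁_
    _∼_ _≁_ : Rel (Fin 19) 0ℓ
    x ∼ y = label x ≡ label y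
    x ≁ y = ¬ x ∼ y

    class? : ∀ x → Decidable (_∼ x)
    class? x z = label z ≟ⁿ label x

    size : Fin 19 → ℕ
    size x = count (class? x)

    -- By homogeneity the colour at `x` extends to its whole class, which becomes one side of a
    -- monochromatic cut.
    no-star-cut : ∀ {o x y} → x ≁ y → ¬ (∀ {z} → x ≁ z → E f o x z)
    no-star-cut {x = x} x≁y star = no-monochromatic-cut (class? x)
      (λ u∼x v≁x → homogeneous (sym u∼x) refl (v≁x ∘ sym) (star (v≁x ∘ sym))) refl (x≁y ∘ sym)

    crossing : ∀ {x y} → x ≁ y → E f a x y ⊎ E f b x y
    crossing x≁y with E-total pal (λ { refl → x≁y refl })
    ... | inj₁ e        = inj₁ e
    ... | inj₂ (inj₁ e) = inj₂ e
    ... | inj₂ (inj₂ e) = contradiction (joined e) x≁y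

    no-centre : ∀ {o x y z} → x ≁ y → x ≁ z → (∀ w → w ∼ x ⊎ w ∼ y ⊎ w ∼ z) → E f o x y → ¬ E f o x z
    no-centre x≁y x≁z cover xy xz = no-star-cut x≁y λ {w} x≁w → case cover w of λ
      { (inj₁ w∼x)        → contradiction (sym w∼x) x≁w
      ; (inj₂ (inj₁ w∼y)) → homogeneous refl (sym w∼y) x≁y xy
      ; (inj₂ (inj₂ w∼z)) → homogeneous refl (sym w∼z) x≁z xz }

    no-two-classes : ∀ {x y} → x ≁ y → ¬ (∀ w → w ∼ x ⊎ w ∼ y)
    no-two-classes x≁y cover =
      [ (λ e → no-centre x≁y x≁y (map₂⊎ ∘ cover) e e) , (λ e → no-centre x≁y x≁y (map₂⊎ ∘ cover) e e) ]′ (crossing x≁y)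
      where
      map₂⊎ : ∀ {A B : Set} → A ⊎ B → A ⊎ B ⊎ B
      map₂⊎ = [ inj₁ , inj₂ ∘ inj₁ ]′

    no-three-classes : ∀ {x y z} → x ≁ y → x ≁ z → y ≁ z → ¬ (∀ w → w ∼ x ⊎ w ∼ y ⊎ w ∼ z)
    no-three-classes {x} {y} {z} x≁y x≁z y≁z cover = case crossing x≁y , crossing x≁z , crossing y≁z of λ
      { (inj₁ xy , inj₁ xz , _) → at-x xy xz
      ; (inj₂ xy , inj₂ xz , _) → at-x xy xz
      ; (inj₁ xy , inj₂ xz , inj₁ yz) → at-y xy yz
      ; (inj₂ xy , inj₁ xz , inj₂ yz) → at-y xy yz
      ; (inj₁ xy , inj₂ xz , inj₂ yz) → at-z xz yz
      ; (inj₂ xy , inj₁ xz , inj₁ yz) → at-z xz yz }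
      where
      at-x : ∀ {o} → E f o x y → ¬ E f o x z
      at-x = no-centre x≁y x≁z cover
      at-y : ∀ {o} → E f o x y → ¬ E f o y z
      at-y xy yz = no-centre (x≁y ∘ sym) y≁z ([ inj₂ ∘ inj₁ , [ inj₁ , inj₂ ∘ inj₂ ]′ ]′ ∘ cover) (E-sym xy) yz
      at-z : ∀ {o} → E f o x z → ¬ E f o y z
      at-z xz yz = no-centre (x≁z ∘ sym) (y≁z ∘ sym) ([ inj₂ ∘ inj₁ , [ inj₂ ∘ inj₂ , inj₁ ]′ ]′ ∘ cover) (E-sym xz) (E-sym yz)

    deg-sum≥7 : ∀ {x y} → x ≁ y → 7 ≤ deg c x + deg c y
    deg-sum≥7 {x} {y} x≁y = ≤-trans
      ([ pages a≢c , pages b≢c ]′ (crossing x≁y))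
      (count-∪-≤ (E? c x) (E? c y))

    exceptional-class : ∃ λ s → ∀ {z} → z ≁ s → 4 ≤ deg c z
    -- If every c-degree is at least four, any `s` serves; otherwise `s` has c-degree at most three
    -- and `deg-sum≥7` handles all other classes.
    exceptional-class = [ (λ 4≤deg → 0F , λ {z} _ → 4≤deg z) , (λ (s , 4≰deg) → s , λ {z} z≁s →
        +-cancelʳ-≤ 3 4 (deg c z) (≤-trans (deg-sum≥7 z≁s) (+-monoʳ-≤ (deg c z) (s≤s⁻¹ (≰⇒> 4≰deg))))) ]′
      (all-or-exception λ z → 4 ≤? deg c z)

    inner? : ∀ o p x → Decidable (λ z → z ∼ p × E f o x z)
    inner? o p x = class? p ∩? E? o x

    outer? : ∀ o p → Decidable (λ z → E f o p z × z ≁ p)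
    outer? o p = E? o p ∩? ∁? (class? p)

    inner-bound : ∀ {o p x} → o ≢ c → x ∼ p → 4 ≤ deg c x → 5 + count (inner? o p x) ≤ size p
    inner-bound {o} {p} {x} o≢c x∼p 4≤deg = begin
      5 + count (inner? o p x)               ≤⟨ s≤s (+-monoˡ-≤ (count (inner? o p x)) 4≤deg) ⟩
      suc (deg c x + count (inner? o p x))   ≤⟨ s≤s (count-∪-disjoint (E? c x) (inner? o p x) (λ e e′ → o≢c (E-unique (proj₂ e′) e))) ⟩
      suc (count (E? c x ∪? inner? o p x))   ≤⟨ count-insert (E? c x ∪? inner? o p x) (class? p) x∼p
                                                  [ (λ e → trans (sym (joined e)) x∼p) , proj₁ ]′
                                                  [ (λ e → proj₁ e refl) , (λ e → proj₁ (proj₂ e) refl) ]′ ⟩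
      size p                                 ∎
      where open ≤-Reasoning

    -- By homogeneity `p` and its c-neighbour `p′` have the same o-neighbours outside their class,
    -- so these enter the seven once, while inner ones are counted at each end. Two uses of
    -- `inner-bound` supply the 10 in 17 = 10 + 7.
    class-ineq : ∀ {o p} → o ≢ c → (∀ {z} → z ∼ p → 4 ≤ deg c z) → 17 ≤ (size p + size p) + count (outer? o p)
    class-ineq {o} {p} o≢c 4≤deg =
      case count>0⇒∃ (E? c p) (≤-trans (s≤s z≤n) (4≤deg refl)) of λ (p′ , pp′) →
      let i  = count (inner? o p p)
          i′ = count (inner? o p p′)
          t  = count (outer? o p)
          split : ∀ {z} → E f o p z ⊎ E f o p′ z → (z ∼ p × E f o p z) ⊎ (z ∼ p × E f o p′ z) ⊎ (E f o p z × z ≁ p)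
          split {z} e = [ (λ z∼p → [ (λ pz → inj₁ (z∼p , pz)) , (λ p′z → inj₂ (inj₁ (z∼p , p′z))) ]′ e)
                        , (λ z≁p → inj₂ (inj₂ ([ id , homogeneous (sym (joined pp′)) refl (λ p′∼z → z≁p (sym (trans (joined pp′) p′∼z))) ]′ e , z≁p)))
                        ]′ (toSum (class? p z))
          7≤ : 7 ≤ i + (i′ + t)
          7≤ = ≤-trans (pages (≢-sym o≢c) pp′)
                (≤-trans (count-cover (inner? o p p) (inner? o p p′ ∪? outer? o p) (E? o p ∪? E? o p′) split)
                         (+-monoʳ-≤ i (count-∪-≤ (inner? o p p′) (outer? o p))))
          open ≤-Reasoning
      in begin
        17                        ≤⟨ +-monoʳ-≤ 10 7≤ ⟩
        10 + (i + (i′ + t))       ≡⟨ solve 3 (λ i i′ t → con 10 :+ (i :+ (i′ :+ t)) := ((con 5 :+ i) :+ (con 5 :+ i′)) :+ t) refl i i′ t ⟩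
        ((5 + i) + (5 + i′)) + t  ≤⟨ +-monoˡ-≤ t (+-mono-≤ (inner-bound o≢c refl (4≤deg refl))
                                                          (inner-bound o≢c (sym (joined pp′)) (4≤deg (sym (joined pp′))))) ⟩
        (size p + size p) + t     ∎

    record Flag (x y : Fin 19) (β : Bool) : Set where
      constructor flag
      field
        a⇒true  : E f a x y → β ≡ true
        b⇒false : E f b x y → not β ≡ true

    Flag-sym : ∀ {x y β} → Flag x y β → Flag y x β
    Flag-sym (flag a⇒ b⇒) = flag (a⇒ ∘ E-sym) (b⇒ ∘ E-sym)

    a-flag : ∀ x y → Flag x y (does (E? a x y))
    a-flag x y = flag (dec-true (E? a x y)) (λ e → cong not (dec-false (E? a x y) λ e′ → a≢b (E-unique e′ e)))

    -- One o-edge from `p` into a class joins `p` to all of that class in `o`, so outer o-neighbours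
    -- lie only in classes whose flag is true.
    outer-bound : ∀ {o p q r s β γ δ} → p ≁ q → p ≁ r → p ≁ s →
                  (∀ w → w ∼ p ⊎ w ∼ q ⊎ w ∼ r ⊎ w ∼ s) →
                  (E f o p q → β ≡ true) → (E f o p r → γ ≡ true) → (E f o p s → δ ≡ true) →
                  count (outer? o p) ≤ weight β (size q) + (weight γ (size r) + weight δ (size s))
    outer-bound {o} {p} {q} {r} {s} {β} {γ} {δ} p≁q p≁r p≁s cover fq fr fs = begin
      count (outer? o p)                                              ≤⟨ count-cover (part? q β) (part? r γ ∪? part? s δ) (outer? o p) split ⟩
      count (part? q β) + count (part? r γ ∪? part? s δ)              ≤⟨ +-mono-≤ (part≤ q β) (≤-trans (count-∪-≤ (part? r γ) (part? s δ)) (+-mono-≤ (part≤ r γ) (part≤ s δ))) ⟩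
      weight β (size q) + (weight γ (size r) + weight δ (size s))     ∎
      where
      open ≤-Reasoning
      part? : ∀ x β → Decidable (λ z → z ∼ x × β ≡ true)
      part? x β z = class? x z ×-dec (β ≟ᵇ true)
      part≤ : ∀ x β → count (part? x β) ≤ weight β (size x)
      part≤ x true  = count-mono (part? x true) (class? x) proj₁
      part≤ x false = ≤-reflexive (count-empty (part? x false) λ z z∈ → case proj₂ z∈ of λ ())
      at : ∀ {x β w} → p ≁ x → (E f o p x → β ≡ true) → E f o p w → w ∼ x → w ∼ x × β ≡ true
      at p≁x fx pw w∼x = w∼x , fx (homogeneous refl w∼x (λ p∼w → p≁x (trans p∼w w∼x)) pw)
      split : ∀ {w} → E f o p w × w ≁ p → (w ∼ q × β ≡ true) ⊎ (w ∼ r × γ ≡ true) ⊎ (w ∼ s × δ ≡ true)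
      split {w} (pw , w≁p) = case cover w of λ
        { (inj₁ w∼p)               → contradiction w∼p w≁p
        ; (inj₂ (inj₁ w∼q))        → inj₁ (at p≁q fq pw w∼q)
        ; (inj₂ (inj₂ (inj₁ w∼r))) → inj₂ (inj₁ (at p≁r fr pw w∼r))
        ; (inj₂ (inj₂ (inj₂ w∼s))) → inj₂ (inj₂ (at p≁s fs pw w∼s)) }

    rich : ∀ {p q r s β γ δ} → p ≁ q → p ≁ r → p ≁ s → (∀ w → w ∼ p ⊎ w ∼ q ⊎ w ∼ r ⊎ w ∼ s) →
           (∀ {z} → z ∼ p → 4 ≤ deg c z) → Flag p q β → Flag p r γ → Flag p s δ →
           Rich (size p) β (size q) γ (size r) δ (size s)
    rich {p} p≁q p≁r p≁s cover 4≤deg (flag aq bq) (flag ar br) (flag as bs) =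
      ≤-trans (class-ineq a≢c 4≤deg) (+-monoʳ-≤ (size p + size p) (outer-bound p≁q p≁r p≁s cover aq ar as)) &
      ≤-trans (class-ineq b≢c 4≤deg) (+-monoʳ-≤ (size p + size p) (outer-bound p≁q p≁r p≁s cover bq br bs))

    size≥5 : ∀ {x} → 4 ≤ deg c x → 5 ≤ size x
    size≥5 {x} 4≤deg = ≤-trans (s≤s 4≤deg)
      (count-insert (E? c x) (class? x) refl (λ e → sym (joined e)) λ e → proj₁ e refl)

    size≥1 : ∀ x → 1 ≤ size x
    size≥1 x = subst (_≤ size x) (count-singleton x) (count-mono (_≟ x) (class? x) (cong label))

    class-disjoint : ∀ {x y z} → x ≁ y → z ∼ x → z ≁ y
    class-disjoint x≁y z∼x z∼y = x≁y (trans (sym z∼x) z∼y)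

    module _ {p q r s} (p≁q : p ≁ q) (p≁r : p ≁ r) (p≁s : p ≁ s) (q≁r : q ≁ r) (q≁s : q ≁ s) (r≁s : r ≁ s) where

      private
        rs? = class? r ∪? class? s
        qrs? = class? q ∪? rs?
        pqrs? = class? p ∪? qrs?

      sizes≤ : size p + (size q + (size r + size s)) ≤ count pqrs?
      sizes≤ =
        ≤-trans (+-monoʳ-≤ (size p)
          (≤-trans (+-monoʳ-≤ (size q)
            (count-∪-disjoint (class? r) (class? s) (class-disjoint r≁s)))
            (count-∪-disjoint (class? q) rs? (λ z∼q → [ class-disjoint q≁r z∼q , class-disjoint q≁s z∼q ]′))))
          (count-∪-disjoint (class? p) qrs?
            (λ z∼p → [ class-disjoint p≁q z∼p , [ class-disjoint p≁r z∼p , class-disjoint p≁s z∼p ]′ ]′))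

      module _ (big : ∀ {z} → z ≁ s → 4 ≤ deg c z) where

        no-four-classes : ¬ (∀ w → w ∼ p ⊎ w ∼ q ⊎ w ∼ r ⊎ w ∼ s)
        no-four-classes cover = no-rich-sizes (size≥5 (big p≁s)) (size≥5 (big q≁s)) (size≥5 (big r≁s)) (size≥1 s) total
          (rich p≁q p≁r p≁s cover (bigger p≁s) (a-flag p q) (a-flag p r) (a-flag p s))
          (rich (p≁q ∘ sym) q≁r q≁s ([ inj₂ ∘ inj₁ , [ inj₁ , inj₂ ∘ inj₂ ]′ ]′ ∘ cover) (bigger q≁s)
            (Flag-sym (a-flag p q)) (a-flag q r) (a-flag q s))
          (rich (p≁r ∘ sym) (q≁r ∘ sym) r≁s
            ([ inj₂ ∘ inj₁ , [ inj₂ ∘ inj₂ ∘ inj₁ , [ inj₁ , inj₂ ∘ inj₂ ∘ inj₂ ]′ ]′ ]′ ∘ cover) (bigger r≁s)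
            (Flag-sym (a-flag p r)) (Flag-sym (a-flag q r)) (a-flag r s))
          where
          bigger : ∀ {x} → x ≁ s → ∀ {z} → z ∼ x → 4 ≤ deg c z
          bigger x≁s z∼x = big (λ z∼s → x≁s (trans (sym z∼x) z∼s))
          open ≤-Reasoning
          total : size p + (size q + (size r + size s)) ≡ 19
          total = ≤-antisym (≤-trans sizes≤ (count≤n pqrs?)) (begin
            19                                       ≡⟨ count-U 19 ⟨
            count {19} U?                            ≤⟨ count-cover (class? p) qrs? U? (λ {w} _ → cover w) ⟩
            size p + count qrs?                      ≤⟨ +-monoʳ-≤ (size p) (≤-trans (count-∪-≤ (class? q) rs?) (+-monoʳ-≤ (size q) (count-∪-≤ (class? r) (class? s)))) ⟩
            size p + (size q + (size r + size s))    ∎)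

        no-fifth-class : ¬ (∃ λ t → ¬ (t ∼ p ⊎ t ∼ q ⊎ t ∼ r ⊎ t ∼ s))
        no-fifth-class (t , t≁) = contradiction (begin
          21                                                    ≤⟨ +-mono-≤ (size≥5 (big (t≁ ∘ inj₂ ∘ inj₂ ∘ inj₂))) (+-mono-≤ (size≥5 (big p≁s)) (+-mono-≤ (size≥5 (big q≁s)) (+-mono-≤ (size≥5 (big r≁s)) (size≥1 s)))) ⟩
          size t + (size p + (size q + (size r + size s)))      ≤⟨ +-monoʳ-≤ (size t) sizes≤ ⟩
          size t + count pqrs?                                  ≤⟨ count-∪-disjoint (class? t) pqrs? disjoint ⟩
          count (class? t ∪? pqrs?)                             ≤⟨ count≤n (class? t ∪? pqrs?) ⟩
          19                                                    ∎) λ 21≤19 → 1+n≰n (≤-trans (n≤1+n 20) 21≤19)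
          where
          open ≤-Reasoning
          disjoint : ∀ {z} → z ∼ t → ¬ (z ∼ p ⊎ z ∼ q ⊎ z ∼ r ⊎ z ∼ s)
          disjoint z∼t = [ class-disjoint (t≁ ∘ inj₁) z∼t , [ class-disjoint (t≁ ∘ inj₂ ∘ inj₁) z∼t
                       , [ class-disjoint (t≁ ∘ inj₂ ∘ inj₂ ∘ inj₁) z∼t , class-disjoint (t≁ ∘ inj₂ ∘ inj₂ ∘ inj₂) z∼t ]′ ]′ ]′

    connected : ∀ x y → x ∼ y
    connected x y = decidable-stable (label x ≟ⁿ label y) λ x≁y →
      case exceptional-class of λ (s , big) →
      case different x≁y s of λ (p , p≁s) →
      [ no-two-classes p≁s , (λ (q , q≁) →
        [ no-three-classes (q≁ ∘ inj₁) (q≁ ∘ inj₂) p≁s , (λ (r , r≁) →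
          [ no-four-classes (r≁ ∘ inj₁) (r≁ ∘ inj₂ ∘ inj₁) (r≁ ∘ inj₂ ∘ inj₂) (q≁ ∘ inj₁) (q≁ ∘ inj₂) p≁s big
          , no-fifth-class (r≁ ∘ inj₁) (r≁ ∘ inj₂ ∘ inj₁) (r≁ ∘ inj₂ ∘ inj₂) (q≁ ∘ inj₁) (q≁ ∘ inj₂) p≁s big
          ]′ (all-or-exception (class? r ∪? (class? q ∪? (class? p ∪? class? s)))))
        ]′ (all-or-exception (class? q ∪? (class? p ∪? class? s))))
      ]′ (all-or-exception (class? p ∪? class? s))
      where
      different : x ≁ y → ∀ s → ∃ λ p → p ≁ s
      different x≁y s = [ (λ x∼s → y , λ y∼s → x≁y (trans x∼s (sym y∼s))) , (λ x≁s → x , x≁s) ]′ (toSum (class? s x))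

  impossible : ⊥
  impossible = case gallai-disconnected 17 f gallai of λ (c , x , y , ¬xy) →
    case other-colours c of λ (a , b , pal) →
    ¬xy (Component.path c (Classes.connected (swap₂₃ (swap₁₂ pal)) x y))

-- Books

Avoids : Colouring 3 (K n) → Fin 3 → Fin n → Fin n → Pred (Fin n) 0ℓ
Avoids f e x y z = ¬ (E f e x z ⊎ E f e y z)

avoids? : (f : Colouring 3 (K n)) (gallai : Gallai f) → ∀ e x y → Decidable (Avoids f e x y)
avoids? f gallai e x y = ∁? (E? e x ∪? E? e y)
  where open GallaiColouring f gallai

book : (f : Colouring 3 (K n)) (gallai : Gallai f) → ∀ {c e x y} → c ≢ e → E f c x y →
       k ≤ count (avoids? f gallai e x y ∩? ∁? ((_≟ x) ∪? (_≟ y))) →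
       ∃ λ (φ : Copy (Book k) (K n)) → UsesAtMost 2 f φ
book {n} {k} f gallai {c} {e} {x} {y} c≢e xy k≤ = φ , ∁ ⁅ e ⁆ , ≤-reflexive (trans (∣∁p∣≡n∸∣p∣ ⁅ e ⁆) (cong (3 ∸_) (∣⁅x⁆∣≡1 e))) ,
  λ u v uv → x∉p⇒x∈∁p λ ∈e → avoids-e u v uv (Copy.edge φ {u} {v} uv , x∈⁅y⁆⇒x≡y e ∈e)
  where
  open GallaiColouring f gallai
  chosen = choose (avoids? f gallai e x y ∩? ∁? ((_≟ x) ∪? (_≟ y))) k≤
  h = proj₁ chosen
  h-injective = proj₁ (proj₂ chosen)
  avoids : ∀ i → Avoids f e x y (h i)
  avoids i = proj₁ (proj₂ (proj₂ chosen) i)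
  h≢x : ∀ i → h i ≢ x
  h≢x i = proj₂ (proj₂ (proj₂ chosen) i) ∘ inj₁
  h≢y : ∀ i → h i ≢ y
  h≢y i = proj₂ (proj₂ (proj₂ chosen) i) ∘ inj₂

  place : Vertex (Book k) → Fin n
  place (inj₁ 0F)      = x
  place (inj₁ 1F)      = y
  place (inj₂ (i , _)) = h i

  place-injective : ∀ {u v} → place u ≡ place v → u ≡ v
  place-injective {inj₁ 0F} {inj₁ 0F} _ = refl
  place-injective {inj₁ 1F} {inj₁ 1F} _ = refl
  place-injective {inj₁ 0F} {inj₁ 1F} eq = contradiction eq (proj₁ xy)
  place-injective {inj₁ 1F} {inj₁ 0F} eq = contradiction (sym eq) (proj₁ xy)
  place-injective {inj₁ 0F} {inj₂ (i , _)} eq = contradiction (sym eq) (h≢x i)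
  place-injective {inj₁ 1F} {inj₂ (i , _)} eq = contradiction (sym eq) (h≢y i)
  place-injective {inj₂ (i , _)} {inj₁ 0F} eq = contradiction eq (h≢x i)
  place-injective {inj₂ (i , _)} {inj₁ 1F} eq = contradiction eq (h≢y i)
  place-injective {inj₂ (i , 0F)} {inj₂ (j , 0F)} eq = cong (λ i → inj₂ (i , 0F)) (h-injective eq)

  φ : Copy (Book k) (K n)
  φ = record
    { map       = place
    ; injective = place-injective
    ; edge      = λ {u} {v} uv eq → Graph.irrefl (Book k) {v} (subst (λ w → Adj (Book k) w v) (place-injective {u} {v} eq) uv)
    }

  avoids-e : ∀ u v → Adj (Book k) u v → ¬ E f e (place u) (place v)
  avoids-e (inj₁ 0F) (inj₁ 0F) uv _ = uv refl
  avoids-e (inj₁ 1F) (inj₁ 1F) uv _ = uv refl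
  avoids-e (inj₁ 0F) (inj₁ 1F) _ e = c≢e (E-unique xy e)
  avoids-e (inj₁ 1F) (inj₁ 0F) _ e = c≢e (E-unique (E-sym xy) e)
  avoids-e (inj₁ 0F) (inj₂ (i , _)) _ e = avoids i (inj₁ e)
  avoids-e (inj₁ 1F) (inj₂ (i , _)) _ e = avoids i (inj₂ e)
  avoids-e (inj₂ (i , _)) (inj₁ 0F) _ e = avoids i (inj₁ (E-sym e))
  avoids-e (inj₂ (i , _)) (inj₁ 1F) _ e = avoids i (inj₂ (E-sym e))
  avoids-e (inj₂ (i , 0F)) (inj₂ (j , 0F)) (_ , uv) _ = uv refl

missing-colour : (S : Subset 3) → ∣ S ∣ ≤ 2 → ∃ (_∉ S)
missing-colour (false ∷ _) _ = 0F , λ ()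
missing-colour (true ∷ false ∷ _) _ = 1F , λ { (there ()) }
missing-colour (true ∷ true ∷ false ∷ []) _ = 2F , λ { (there (there ())) }
missing-colour (true ∷ true ∷ true ∷ []) (s≤s (s≤s ()))

-- The two ends of the spine avoid e as well, as E is irreflexive.
book⇒avoids : (f : Colouring 3 (K n)) (gallai : Gallai f) (φ : Copy (Book k) (K n)) → UsesAtMost 2 f φ →
              ∃₂ λ x y → ∃₂ λ c e → c ≢ e × E f c x y × 2 + k ≤ count (avoids? f gallai e x y)
book⇒avoids {n} {k} f gallai φ (S , ∣S∣≤2 , ∈S) = x , y , c , e , ∈S⇒≢ (∈S (inj₁ 0F) (inj₁ 1F) λ ()) , (edge {inj₁ 0F} {inj₁ 1F} (λ ()) , refl) ,
  injective⇒≤count (avoids? f gallai e x y) vertex vertex-injective avoids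
  where
  open Copy φ
  e = proj₁ (missing-colour S ∣S∣≤2)
  x = map (inj₁ 0F)
  y = map (inj₁ 1F)
  c = colour f x y (edge {inj₁ 0F} {inj₁ 1F} λ ())
  ∈S⇒≢ : ∀ {d} → d ∈ S → d ≢ e
  ∈S⇒≢ d∈S refl = proj₂ (missing-colour S ∣S∣≤2) d∈S

  place : Fin (2 + k) → Vertex (Book k)
  place 0F            = inj₁ 0F
  place 1F            = inj₁ 1F
  place (suc (suc i)) = inj₂ (i , 0F)

  vertex = map ∘ place

  place-injective : ∀ {i j} → place i ≡ place j → i ≡ j
  place-injective {0F} {0F} _ = refl
  place-injective {0F} {1F} ()
  place-injective {0F} {suc (suc j)} ()
  place-injective {1F} {0F} ()
  place-injective {1F} {1F} _ = refl
  place-injective {1F} {suc (suc j)} ()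
  place-injective {suc (suc i)} {0F} ()
  place-injective {suc (suc i)} {1F} ()
  place-injective {suc (suc i)} {suc (suc j)} refl = refl

  vertex-injective : Injective _≡_ _≡_ vertex
  vertex-injective eq = place-injective (injective eq)

  no-e : ∀ u v → Adj (Book k) u v → ¬ E f e (map u) (map v)
  no-e u v uv (_ , eq) = ∈S⇒≢ (∈S u v uv) eq

  avoids : ∀ i → Avoids f e x y (vertex i)
  avoids 0F            = [ (λ e → proj₁ e refl) , no-e (inj₁ 1F) (inj₁ 0F) (λ ()) ]′
  avoids 1F            = [ no-e (inj₁ 0F) (inj₁ 1F) (λ ()) , (λ e → proj₁ e refl) ]′
  avoids (suc (suc i)) = [ no-e (inj₁ 0F) (inj₂ (i , 0F)) tt , no-e (inj₁ 1F) (inj₂ (i , 0F)) tt ]′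

-- The bounds at 19 and at 18

forces-19 : Forces 3 2 (Book 11) 19
forces-19 f gallai = [ found , (λ none → ⊥-elim (Bookless.impossible f gallai λ c≢e xy →
    ≮⇒≥ λ few → none (_ , _ , _ , _ , c≢e , xy , few))) ]′ (toSum few-pages?)
  where
  open GallaiColouring f gallai
  FewPages : Set
  FewPages = ∃₂ λ x y → ∃₂ λ c e → c ≢ e × E f c x y × count (E? e x ∪? E? e y) < 7
  few-pages? : Dec FewPages
  few-pages? = any? λ x → any? λ y → any? λ c → any? λ e →
    ¬? (c ≟ e) ×-dec (E? c x y ×-dec (count (E? e x ∪? E? e y) <? 7))
  found : FewPages → ∃ λ (φ : Copy (Book 11) (K 19)) → UsesAtMost 2 f φ
  -- At most six vertices meet `e` and two form the spine: 19 - 6 - 2 = 11 pages remain.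
  found (x , y , c , e , c≢e , xy , few) = book f gallai c≢e xy (+-cancelʳ-≤ 8 11 (count good?) (begin
    19                                 ≡⟨ count-U 19 ⟨
    count {19} U?                      ≤⟨ count-cover good? bad? U? (λ {z} _ → split z) ⟩
    count good? + count bad?           ≤⟨ +-monoʳ-≤ (count good?) (≤-trans (count-∪-≤ e? xy?) (+-mono-≤ (s≤s⁻¹ few) xy≤2)) ⟩
    count good? + 8                    ∎))
    where
    open ≤-Reasoning
    e? = E? e x ∪? E? e y
    xy? = (_≟ x) ∪? (_≟ y)
    bad? = e? ∪? xy?
    good? = avoids? f gallai e x y ∩? ∁? xy?
    xy≤2 : count xy? ≤ 2
    xy≤2 = ≤-trans (count-∪-≤ (_≟ x) (_≟ y)) (+-mono-≤ (≤-reflexive (count-singleton x)) (≤-reflexive (count-singleton y)))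
    split : ∀ z → (Avoids f e x y z × ¬ (z ≡ x ⊎ z ≡ y)) ⊎ ((E f e x z ⊎ E f e y z) ⊎ (z ≡ x ⊎ z ≡ y))
    split z = [ inj₂ ∘ inj₁ , (λ ¬e → [ inj₂ ∘ inj₂ , (λ ¬xy → inj₁ (¬e , ¬xy)) ]′ (toSum (xy? z))) ]′ (toSum (e? z))

-- Leastness speaks of every smaller order; restricting a colouring to its first `m` vertices lets a
-- single colouring of order 18 refute them all.
Forces-mono : ∀ {s G} → m ≤ n → Forces 3 s G m → Forces 3 s G n
Forces-mono {m} {n} {s} {G} m≤n forces f gallai = extend (forces (pullback ι ι-injective f) (pullback-Gallai ι ι-injective f gallai))
  where
  ι : Fin m → Fin n
  ι i = inject≤ i m≤n
  ι-injective : Injective _≡_ _≡_ ι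
  ι-injective = inject≤-injective m≤n m≤n _ _
  extend : (∃ λ (φ : Copy G (K m)) → UsesAtMost s (pullback ι ι-injective f) φ) → ∃ λ (φ : Copy G (K n)) → UsesAtMost s f φ
  extend (φ , S , ∣S∣≤s , ∈S) = record
    { map       = ι ∘ Copy.map φ
    ; injective = Copy.injective φ ∘ ι-injective
    ; edge      = λ uv → Copy.edge φ uv ∘ ι-injective
    } , S , ∣S∣≤s , ∈S

-- Two copies of the Paley colouring of K₉ (rook's graph and its complement, in colours 1 and 2)
-- with all edges between them in colour 0.
rook : Fin 3 × Fin 3 → Fin 3 × Fin 3 → Fin 3
rook (i , j) (i′ , j′) = if does (i ≟ i′) ∨ does (j ≟ j′) then 1F else 2F

two-rooks : Fin 18 → Fin 18 → Fin 3
two-rooks u v with remQuot {2} 9 u | remQuot {2} 9 v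
... | s , x | s′ , y = if does (s ≟ s′) then rook (remQuot 3 x) (remQuot 3 y) else 0F

two-rooks-colouring : Colouring 3 (K 18)
two-rooks-colouring = record
  { colour = λ u v _ → two-rooks u v
  ; symm   = λ u v _ → toWitness {a? = all? λ u → all? λ v → two-rooks u v ≟ two-rooks v u} tt u v
  }

two-rooks-Gallai : Gallai two-rooks-colouring
two-rooks-Gallai x y z _ _ _ = toWitness {a? = all? λ x → all? λ y → all? λ z →
  ¬? (¬? (two-rooks x y ≟ two-rooks x z) ×-dec (¬? (two-rooks x y ≟ two-rooks y z) ×-dec
  ¬? (two-rooks x z ≟ two-rooks y z)))} tt x y z

opaque
  unfolding count

  -- The count includes both ends of the spine, so 13 = 2 + 11. The largest value is 12, for a spine
  -- inside one copy and the other colour of that copy missing: both ends, their single common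
  -- neighbour in the Paley graph, and all nine vertices of the other copy.
  two-rooks-avoids : ∀ x y c e → c ≢ e → E two-rooks-colouring c x y →
                     ¬ 13 ≤ count (avoids? two-rooks-colouring two-rooks-Gallai e x y)
  two-rooks-avoids = toWitness {a? = all? λ x → all? λ y → all? λ c → all? λ e →
    ¬? (c ≟ e) →-dec (GallaiColouring.E? two-rooks-colouring two-rooks-Gallai c x y →-dec ¬? (13 ≤? _))} tt

¬forces-18 : ¬ Forces 3 2 (Book 11) 18
¬forces-18 forces = case forces two-rooks-colouring two-rooks-Gallai of λ (φ , at-most-2) →
  case book⇒avoids two-rooks-colouring two-rooks-Gallai φ at-most-2 of λ (x , y , c , e , c≢e , xy , many) →
  two-rooks-avoids x y c e c≢e xy many

theorem4p7 : gr[ 3 , 2 , Book 11 ]≡ 19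
theorem4p7 = forces-19 , λ q forces → ≮⇒≥ λ q<19 → ¬forces-18 (Forces-mono (s≤s⁻¹ q<19) forces)
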